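{- Let $s,s'$ and $t_1,\dots,t_n,t_1',\dots,t_n'$ be closed infinitary lambda trees such that $s\,t_1\dots t_n$ and $s'\,t'_1\dots t'_n$ are well typed of type $\iota$, and let $k\in\mathbb N$. If $s\sim_k s'$ and $t_i\sim_k t_i'$ for all $i$, then $\mathrm{cn}(s;\vec t)\sim_k\mathrm{cn}(s';\vec t')$.
   Context: $\Sigma'$ is a ranked alphabet, $\Sigma=\Sigma'\cup\{\mathcal R,\beta\}$ with $\mathcal R,\beta$ unary. Infinitary simply-typed lambda trees: possibly non-well-founded type-correct trees built from variables, $\lambda x^\rho$-abstractions, applications and constants $\mathfrak f\in\Sigma'$ of type $\iota^{\mathrm{ar}(\mathfrak f)}\to\iota$. Continuous normal form (coinductively, for closed $t,\vec t$ with $t\vec t:\iota$): $\mathrm{cn}(rs;\vec t)=\mathcal R(\mathrm{cn}(r;s,\vec t))$, $\mathrm{cn}(\lambda x.r;s,\vec t)=\beta(\mathrm{cn}(r[s/x];\vec t))$, $\mathrm{cn}(\mathfrak f;\vec t)=\mathfrak f(t_1^\beta,\dots,t_n^\beta)$, $t^\beta=\mathrm{cn}(t;())$. Relations $\sim_k$ (agreement up to depth $k$), by induction on $k$: for $\Sigma$-terms, $r\sim_0 s$ always, and $\mathfrak f(r_1,\dots,r_m)\sim_{k+1}\mathfrak f(s_1,\dots,s_m)$ if $r_i\sim_k s_i$ for all $i$. For lambda trees, $r\sim_0 s$ always; $\lambda x.r\sim_{k+1}\lambda x.s$ if $r\sim_k s$; $rs\sim_{k+1}r's'$ if $r\sim_k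 r'$ and $s\sim_k s'$; $x\sim_k x$ and $\mathfrak f\sim_k\mathfrak f$ for all $k$. No other instances hold. -}

module Defs where

-- No coinduction is available here (the --guardedness flag is not allowed,
-- and it is infective), so possibly non-well-founded trees are represented
-- as labellings of finite addresses:  a tree is a function  List ℕ → Label,
-- where the address  i ∷ p  means "go to the i-th child (0-based), then
-- follow p".  Labels at addresses that do not exist in the tree (below a
-- leaf, or beyond the arity of a node) are irrelevant; every notion below
-- only inspects addresses that exist.

open import Data.Nat using (ℕ; zero; suc; _<_; _∸_; _+_; _<ᵇ_; _≡ᵇ_)
open import Data.List using (List; []; _∷_)
open import Data.Maybe using (Maybe; just; nothing)
open import Data.Unit using (⊤)
open import Data.Empty using (⊥)
open import Data.Bool using (if_then_else_)
open import Data.Product using (Σ; _×_)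
open import Relation.Binary.PropositionalEquality using (_≡_)

record RankedAlphabet : Set₁ where
  field
    Sym : Set
    ar  : Sym → ℕ

infixr 5 _⇒_
data Ty : Set where
  ι   : Ty
  _⇒_ : Ty → Ty → Ty

ιs : ℕ → Ty
ιs zero    = ι
ιs (suc n) = ι ⇒ ιs n

-- contexts; variables are de Bruijn indices (index 0 = innermost binder)
Ctx : Set
Ctx = List Ty

_‼_ : Ctx → ℕ → Maybe Ty
[]      ‼ n       = nothing
(ρ ∷ Γ) ‼ zero    = just ρ
(ρ ∷ Γ) ‼ suc n   = Γ ‼ n

Addr : Set
Addr = List ℕ

module Lam (A : RankedAlphabet) where
  open RankedAlphabet A

  -- Infinitary lambda trees (Church style).
  --   var n : the variable with de Bruijn index n           (no children)
  --   lam α : λx^α. _                                       (child 0 = body)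
  --   app α : application r s with s : α                   (child 0 = r, child 1 = s)
  --   con 𝔣 : the constant 𝔣 : ι^ar(𝔣) → ι                 (no children)
  -- (the argument type α on app nodes just records the type of the
  --  argument, which is determined in a type-correct tree)
  data Lbl : Set where
    var : ℕ → Lbl
    lam : Ty → Lbl
    app : Ty → Lbl
    con : Sym → Lbl

  Tree : Set
  Tree = Addr → Lbl

  child : ∀ {L : Set} → (Addr → L) → ℕ → (Addr → L)
  child t i p = t (i ∷ p)

  WT : ℕ → Ctx → Ty → Tree → Set
  WTL : ℕ → Ctx → Ty → Tree → Lbl → Set
  WT zero    Γ ρ t = ⊤
  WT (suc k) Γ ρ t = WTL k Γ ρ t (t [])
  WTL k Γ ρ t (var n) = Γ ‼ n ≡ just ρ
  WTL k Γ ρ t (lam α) = Σ Ty λ β → ρ ≡ α ⇒ β × WT k (α ∷ Γ) β (child t 0)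
  WTL k Γ ρ t (app α) = WT k Γ (α ⇒ ρ) (child t 0) × WT k Γ α (child t 1)
  WTL k Γ ρ t (con f) = ρ ≡ ιs (ar f)

  Typed : Ctx → Ty → Tree → Set
  Typed Γ ρ t = ∀ k → WT k Γ ρ t

  shift : ℕ → ℕ → Tree → Tree
  shiftL : ℕ → ℕ → Lbl → Lbl
  shiftL c d (var n) = if n <ᵇ c then var n else var (n + d)
  shiftL c d l       = l
  shift c d t []      = shiftL c d (t [])
  shift c d t (i ∷ p) with t []
  ... | lam α = shift (suc c) d (child t i) p
  ... | _     = shift c d (child t i) p

  substAt : ℕ → Tree → Tree → Tree
  substAt d r s [] with r []
  ... | var n = if n <ᵇ d then var n
                else if n ≡ᵇ d then shift 0 d s []
                else var (n ∸ 1)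
  ... | l     = l
  substAt d r s (i ∷ p) with r []
  ... | var n = if n ≡ᵇ d then shift 0 d s (i ∷ p) else r (i ∷ p)
  ... | lam α = substAt (suc d) (child r i) s p
  ... | _     = substAt d (child r i) s p

  _[_] : Tree → Tree → Tree
  r [ s ] = substAt 0 r s

  data SpineTyped : Ty → List Tree → Set where
    []  : SpineTyped ι []
    _∷_ : ∀ {ρ σ t ts} → Typed [] ρ t → SpineTyped σ ts → SpineTyped (ρ ⇒ σ) (t ∷ ts)

  -- Σ-terms, Σ = Σ' ∪ {R, β} (R, β unary).  'junk' is only produced by
  -- cn on ill-typed input and never occurs for type-correct input.
  data SLbl : Set where
    R    : SLbl
    β    : SLbl
    sym  : Sym → SLbl
    junk : SLbl

  sar : SLbl → ℕ
  sar R       = 1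
  sar β       = 1
  sar (sym f) = ar f
  sar junk    = 0

  STree : Set
  STree = Addr → SLbl

  -- continuous normal form cn(t; t⃗), computed address by address:
  --   cn(r s; t⃗)      = R(cn(r; s, t⃗))
  --   cn(λx.r; s, t⃗) = β(cn(r[s/x]; t⃗))
  --   cn(𝔣; t⃗)       = 𝔣(t₁^β, …, tₙ^β),   t^β = cn(t; ())
  nth : List Tree → ℕ → Maybe Tree
  nth []       n       = nothing
  nth (t ∷ ts) zero    = just t
  nth (t ∷ ts) (suc n) = nth ts n

  cn : Tree → List Tree → STree
  cn t ts [] with t []
  ... | app α = R
  ... | lam α = β
  ... | con f = sym f
  ... | var n = junk
  cn t ts (i ∷ p) with t [] | ts
  ... | app α | ts'      = cn (child t 0) (child t 1 ∷ ts') p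
  ... | lam α | s ∷ ts'  = cn (child t 0 [ s ]) ts' p
  ... | lam α | []       = junk
  ... | con f | ts'      with nth ts' i
  ...   | just ti        = cn ti [] p
  ...   | nothing        = junk
  cn t ts (i ∷ p) | var n | ts' = junk

  _ᵝ : Tree → STree
  t ᵝ = cn t []

  _∼S⟨_⟩_ : STree → ℕ → STree → Set
  r ∼S⟨ zero ⟩  s = ⊤
  r ∼S⟨ suc k ⟩ s = (r [] ≡ s []) × (∀ i → i < sar (r []) → child r i ∼S⟨ k ⟩ child s i)

  _∼⟨_⟩_ : Tree → ℕ → Tree → Set
  simL : ℕ → Tree → Tree → Lbl → Lbl → Set
  r ∼⟨ zero ⟩  s = ⊤
  r ∼⟨ suc k ⟩ s = simL k r s (r []) (s [])
  simL k r s (lam α) (lam α') = α ≡ α' × (child r 0 ∼⟨ k ⟩ child s 0)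
  simL k r s (app _) (app _)  = (child r 0 ∼⟨ k ⟩ child s 0) × (child r 1 ∼⟨ k ⟩ child s 1)
  simL k r s (var n) (var m)  = n ≡ m
  simL k r s (con f) (con g)  = f ≡ g
  simL k r s _       _        = ⊥

-- cn is computed one node at a time from the head of s and the spine, so by
-- induction on k it suffices that ∼k is preserved by shifting and by
-- substitution; the typing hypotheses are not needed, since ill-formed
-- positions produce the same junk on both sides.
module Submission where

open import Defs
open import Data.Nat using (ℕ; zero; suc; _<_; _<ᵇ_; _≡ᵇ_; s≤s)
open import Data.List using (List; []; _∷_)
open import Data.List.Relation.Binary.Pointwise using (Pointwise; []; _∷_)
import Data.List.Relation.Binary.Pointwise as List
open import Data.Maybe using (Maybe; just; nothing)
import Data.Maybe.Relation.Binary.Pointwise as Maybe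
open import Data.Bool using (true; false)
open import Data.Unit using (tt)
open import Data.Product using (_,_)
open import Relation.Binary.PropositionalEquality
  using (_≡_; refl; subst; subst₂; _≗_)
  renaming (sym to ≡-sym)

module _ (A : RankedAlphabet) where
  open RankedAlphabet A
  open Lam A

  ∼-pred : ∀ k r s → r ∼⟨ suc k ⟩ s → r ∼⟨ k ⟩ s
  ∼-pred zero    r s _ = tt
  ∼-pred (suc k) r s h with r [] | s []
  ∼-pred (suc k) r s (refl , h₀) | lam α | lam .α = refl , ∼-pred k (child r 0) (child s 0) h₀
  ∼-pred (suc k) r s (h₀ , h₁)   | app _ | app _  =
    ∼-pred k (child r 0) (child s 0) h₀ , ∼-pred k (child r 1) (child s 1) h₁
  ∼-pred (suc k) r s h | var _ | var _ = h
  ∼-pred (suc k) r s h | con _ | con _ = h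

  ∼-pred-spine : ∀ k {ts ts'} → Pointwise (λ t t' → t ∼⟨ suc k ⟩ t') ts ts'
               → Pointwise (λ t t' → t ∼⟨ k ⟩ t') ts ts'
  ∼-pred-spine k = List.map (λ {t} {t'} → ∼-pred k t t')

  ∼-resp-≗ : ∀ k {r r' s s'} → r ≗ r' → s ≗ s' → r ∼⟨ k ⟩ s → r' ∼⟨ k ⟩ s'
  ∼-resp-≗ zero    _ _ _ = tt
  ∼-resp-≗ (suc k) {r} {r'} {s} {s'} e f h
    rewrite ≡-sym (e []) | ≡-sym (f []) = at-root (r []) (s []) h
    where
    onChild : ∀ i → child r i ∼⟨ k ⟩ child s i → child r' i ∼⟨ k ⟩ child s' i
    onChild i = ∼-resp-≗ k (λ p → e (i ∷ p)) (λ p → f (i ∷ p))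

    at-root : ∀ a b → simL k r s a b → simL k r' s' a b
    at-root (lam _) (lam _) (refl , h₀) = refl , onChild 0 h₀
    at-root (app _) (app _) (h₀ , h₁)   = onChild 0 h₀ , onChild 1 h₁
    at-root (var _) (var _) h           = h
    at-root (con _) (con _) h           = h

  ∼S-resp-≗ : ∀ k {r r' s s'} → r ≗ r' → s ≗ s' → r ∼S⟨ k ⟩ s → r' ∼S⟨ k ⟩ s'
  ∼S-resp-≗ zero    _ _ _ = tt
  ∼S-resp-≗ (suc k) e f (h₀ , h₁) rewrite ≡-sym (e []) | ≡-sym (f []) =
    h₀ , λ i i< → ∼S-resp-≗ k (λ p → e (i ∷ p)) (λ p → f (i ∷ p)) (h₁ i i<)

  child-shift-lam : ∀ {α} c d t → t [] ≡ lam α → ∀ i → shift (suc c) d (child t i) ≗ child (shift c d t) i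
  child-shift-lam c d t e i p rewrite e = refl

  child-shift-app : ∀ {α} c d t → t [] ≡ app α → ∀ i → shift c d (child t i) ≗ child (shift c d t) i
  child-shift-app c d t e i p rewrite e = refl

  child-substAt-lam : ∀ {α} d r s → r [] ≡ lam α → ∀ i → substAt (suc d) (child r i) s ≗ child (substAt d r s) i
  child-substAt-lam d r s e i p rewrite e = refl

  child-substAt-app : ∀ {α} d r s → r [] ≡ app α → ∀ i → substAt d (child r i) s ≗ child (substAt d r s) i
  child-substAt-app d r s e i p rewrite e = refl

  substAt-var-hit : ∀ {n} d r s → r [] ≡ var n → (n <ᵇ d) ≡ false → (n ≡ᵇ d) ≡ true
                  → shift 0 d s ≗ substAt d r s
  substAt-var-hit d r s e e< e≡ []      rewrite e | e< | e≡ = refl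
  substAt-var-hit d r s e e< e≡ (i ∷ p) rewrite e | e≡ = refl

  shift-cong : ∀ k c d t t' → t ∼⟨ k ⟩ t' → shift c d t ∼⟨ k ⟩ shift c d t'
  shift-cong zero    c d t t' _ = tt
  shift-cong (suc k) c d t t' h with t [] in e | t' [] in e'
  shift-cong (suc k) c d t t' (refl , h₀) | lam α | lam .α =
    refl , ∼-resp-≗ k (child-shift-lam c d t e 0) (child-shift-lam c d t' e' 0)
                      (shift-cong k (suc c) d (child t 0) (child t' 0) h₀)
  shift-cong (suc k) c d t t' (h₀ , h₁) | app _ | app _ =
    ∼-resp-≗ k (child-shift-app c d t e 0) (child-shift-app c d t' e' 0)
               (shift-cong k c d (child t 0) (child t' 0) h₀) ,
    ∼-resp-≗ k (child-shift-app c d t e 1) (child-shift-app c d t' e' 1)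
               (shift-cong k c d (child t 1) (child t' 1) h₁)
  shift-cong (suc k) c d t t' refl | var n | var .n with n <ᵇ c
  ... | true  = refl
  ... | false = refl
  shift-cong (suc k) c d t t' h | con _ | con _ = h

  substAt-cong : ∀ k d r r' s s' → r ∼⟨ k ⟩ r' → s ∼⟨ k ⟩ s' → substAt d r s ∼⟨ k ⟩ substAt d r' s'
  substAt-cong zero    d r r' s s' _ _ = tt
  substAt-cong (suc k) d r r' s s' h hs with r [] in e | r' [] in e'
  substAt-cong (suc k) d r r' s s' (refl , h₀) hs | lam α | lam .α =
    refl , ∼-resp-≗ k (child-substAt-lam d r s e 0) (child-substAt-lam d r' s' e' 0)
                      (substAt-cong k (suc d) (child r 0) (child r' 0) s s' h₀ (∼-pred k s s' hs))
  substAt-cong (suc k) d r r' s s' (h₀ , h₁) hs | app _ | app _ =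
    ∼-resp-≗ k (child-substAt-app d r s e 0) (child-substAt-app d r' s' e' 0)
               (substAt-cong k d (child r 0) (child r' 0) s s' h₀ (∼-pred k s s' hs)) ,
    ∼-resp-≗ k (child-substAt-app d r s e 1) (child-substAt-app d r' s' e' 1)
               (substAt-cong k d (child r 1) (child r' 1) s s' h₁ (∼-pred k s s' hs))
  substAt-cong (suc k) d r r' s s' refl hs | var n | var .n with n <ᵇ d in e< | n ≡ᵇ d in e≡
  ... | true  | _     = refl
  ... | false | false = refl
  ... | false | true  =
    subst₂ (simL k (substAt d r s) (substAt d r' s')) (≡-sym (hit [])) (≡-sym (hit' []))
      (∼-resp-≗ (suc k) hit hit' (shift-cong (suc k) 0 d s s' hs))
    where
    hit : shift 0 d s ≗ substAt d r s
    hit = substAt-var-hit d r s e e< e≡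
    hit' : shift 0 d s' ≗ substAt d r' s'
    hit' = substAt-var-hit d r' s' e' e< e≡
  substAt-cong (suc k) d r r' s s' h hs | con _ | con _ = h

  junkT : STree
  junkT _ = junk

  node₁ : SLbl → STree → STree
  node₁ l c []      = l
  node₁ l c (_ ∷ p) = c p

  argᵝ : Maybe Tree → STree
  argᵝ (just t) = t ᵝ
  argᵝ nothing  = junkT

  symNode : Sym → List Tree → STree
  symNode f ts []      = sym f
  symNode f ts (i ∷ p) = argᵝ (nth ts i) p

  cn-app : ∀ {α} s ts → s [] ≡ app α → node₁ R (cn (child s 0) (child s 1 ∷ ts)) ≗ cn s ts
  cn-app s ts e []      rewrite e = refl
  cn-app s ts e (_ ∷ p) rewrite e = refl

  cn-lam : ∀ {α} s t ts → s [] ≡ lam α → node₁ β (cn (child s 0 [ t ]) ts) ≗ cn s (t ∷ ts)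
  cn-lam s t ts e []      rewrite e = refl
  cn-lam s t ts e (_ ∷ p) rewrite e = refl

  cn-lam-[] : ∀ {α} s → s [] ≡ lam α → node₁ β junkT ≗ cn s []
  cn-lam-[] s e []      rewrite e = refl
  cn-lam-[] s e (_ ∷ p) rewrite e = refl

  cn-var : ∀ {n} s ts → s [] ≡ var n → junkT ≗ cn s ts
  cn-var s ts e []      rewrite e = refl
  cn-var s ts e (_ ∷ p) rewrite e = refl

  cn-con : ∀ {f} s ts → s [] ≡ con f → symNode f ts ≗ cn s ts
  cn-con s ts e [] rewrite e = refl
  cn-con s ts e (i ∷ p) rewrite e with nth ts i
  ... | just _  = refl
  ... | nothing = refl

  junk-∼S : ∀ k → junkT ∼S⟨ k ⟩ junkT
  junk-∼S zero    = tt
  junk-∼S (suc k) = refl , λ _ ()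

  node₁-cong : ∀ k l {c c'} → sar l ≡ 1 → c ∼S⟨ k ⟩ c' → node₁ l c ∼S⟨ suc k ⟩ node₁ l c'
  node₁-cong k l {c} {c'} unary h = refl , onChild
    where
    onChild : ∀ i → i < sar l → child (node₁ l c) i ∼S⟨ k ⟩ child (node₁ l c') i
    onChild zero    _  = h
    onChild (suc i) i< with s≤s () ← subst (suc i <_) unary i<

  nth-cong : ∀ {P : Tree → Tree → Set} {ts ts'} → Pointwise P ts ts'
           → ∀ i → Maybe.Pointwise P (nth ts i) (nth ts' i)
  nth-cong []       i       = Maybe.nothing
  nth-cong (h ∷ _)  zero    = Maybe.just h
  nth-cong (_ ∷ hs) (suc i) = nth-cong hs i

  cn-cong : ∀ k s s' ts ts' → s ∼⟨ k ⟩ s' → Pointwise (λ t t' → t ∼⟨ k ⟩ t') ts ts'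
          → cn s ts ∼S⟨ k ⟩ cn s' ts'

  argᵝ-cong : ∀ k {a b} → Maybe.Pointwise (λ t t' → t ∼⟨ suc k ⟩ t') a b → argᵝ a ∼S⟨ k ⟩ argᵝ b
  argᵝ-cong k Maybe.nothing            = junk-∼S k
  argᵝ-cong k (Maybe.just {t} {t'} h) = cn-cong k t t' [] [] (∼-pred k t t' h) []

  cn-cong-root : ∀ k s s' ts ts' a b → s [] ≡ a → s' [] ≡ b → simL k s s' a b
               → Pointwise (λ t t' → t ∼⟨ suc k ⟩ t') ts ts' → cn s ts ∼S⟨ suc k ⟩ cn s' ts'
  cn-cong-root k s s' ts ts' (app _) (app _) e e' (h₀ , h₁) hts =
    ∼S-resp-≗ (suc k) (cn-app s ts e) (cn-app s' ts' e')
      (node₁-cong k R refl (cn-cong k _ _ _ _ h₀ (h₁ ∷ ∼-pred-spine k hts)))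
  cn-cong-root k s s' [] [] (lam _) (lam _) e e' _ [] =
    ∼S-resp-≗ (suc k) (cn-lam-[] s e) (cn-lam-[] s' e') (node₁-cong k β refl (junk-∼S k))
  cn-cong-root k s s' (t ∷ ts) (t' ∷ ts') (lam _) (lam _) e e' (refl , h₀) (ht ∷ hts) =
    ∼S-resp-≗ (suc k) (cn-lam s t ts e) (cn-lam s' t' ts' e')
      (node₁-cong k β refl
        (cn-cong k _ _ ts ts' (substAt-cong k 0 (child s 0) (child s' 0) t t' h₀ (∼-pred k t t' ht))
                              (∼-pred-spine k hts)))
  cn-cong-root k s s' ts ts' (con f) (con .f) e e' refl hts =
    ∼S-resp-≗ (suc k) (cn-con s ts e) (cn-con s' ts' e')
      (refl , λ i _ → argᵝ-cong k (nth-cong hts i))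
  cn-cong-root k s s' ts ts' (var _) (var _) e e' _ _ =
    ∼S-resp-≗ (suc k) (cn-var s ts e) (cn-var s' ts' e') (junk-∼S (suc k))

  cn-cong zero    s s' ts ts' _ _ = tt
  cn-cong (suc k) s s' ts ts' = cn-cong-root k s s' ts ts' (s []) (s' []) refl refl

proposition5p8 : (A : RankedAlphabet) (k : ℕ) (ρ ρ' : Ty)
    → (s s' : Lam.Tree A) (ts ts' : List (Lam.Tree A))
    → Lam.Typed A [] ρ s → Lam.SpineTyped A ρ ts
    → Lam.Typed A [] ρ' s' → Lam.SpineTyped A ρ' ts'
    → Lam._∼⟨_⟩_ A s k s'
    → Pointwise (λ t t' → Lam._∼⟨_⟩_ A t k t') ts ts'
    → Lam._∼S⟨_⟩_ A (Lam.cn A s ts) k (Lam.cn A s' ts')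
proposition5p8 A k ρ ρ' s s' ts ts' _ _ _ _ = cn-cong A k s s' ts ts'
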